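{- Assume the constraint theory $CT$ allows the built-in predicate $=$ and the signature contains at least a constant symbol and a function symbol of arity $>0$. Let $\mathcal{G}$ be a class of goals such that if $H$ is a head of a rule then $K\in\mathcal{G}$ for any $K\subseteq H$ (multiset inclusion). Then, for $n\ge 2$, there exists no acceptable encoding for qualified answers of $\mathrm{CHR}_{n,t}$ into $\mathrm{CHR}_1$ for the class $\mathcal{G}$.
   Context: **CHR.** Fix a signature whose predicate symbols are split into two disjoint sets $\Pi_b$ (built-in) and $\Pi_u$ (user-defined), and a first-order theory $CT$ giving the meaning of built-ins. Built-in constraints are given by $c::=a\mid c\wedge c\mid\exists_x c$ with $a$ an atomic formula over $\Pi_b$; a user-defined constraint is an atomic formula over $\Pi_u$. Conjunctions of atomic constraints are treated as multisets; "," denotes conjunction (multiset union); ${\tt true}$ is the empty multiset of built-in constraints. $Fv(\phi)$ is the set of free variables of $\phi$, and $\exists_{ -V}\phi$ is the existential closure of $\phi$ except for the variables in $V$. $p(\bar t)=p(\bar t')$ denotes the componentwise equalities $\bar t=\bar t'$ (undefined for different predicate symbols), extended in the expected way to multisets of constraints. A simplification rule has the form $H\Leftrightarrow C\mid B$ and a propagation rule the form $H\Rightarrow C\mid B$, where the head $H$ is a nonempty multiset of user-defined constraints, the guard $C$ a multiset of built-in constraints, and the body $B$ a multiset of constraints of both kinds. A program is a finite set of rules; a goal is a multiset of constraints of both kinds. Configurations are triples $\langle G,K,d\rangle$ ($G$ the constraints still to be solved, $K$ the accumulated user-defined constraints, $d$ a built-in constraint). For a program $P$, the relation $\longrightarrow$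 is the least one such that: - Solve: $\langle (c,G),K,d\rangle\longrightarrow\langle G,K,d'\rangle$ if $c$ is built-in and $CT\models c\wedge d\leftrightarrow d'$; - Introduce: $\langle (h,G),K,d\rangle\longrightarrow\langle G,(h,K),d\rangle$ if $h$ is user-defined; - Simplify: $\langle G,H'\wedge K,d\rangle\longrightarrow\langle B\wedge G,K,H=H'\wedge d\rangle$ if $(H\Leftrightarrow C\mid B)\in P$, $x=Fv(H)$ and $CT\models d\rightarrow\exists_x((H=H')\wedge C)$; - Propagate: $\langle G,H'\wedge K,d\rangle\longrightarrow\langle B\wedge G,H'\wedge K,H=H'\wedge d\rangle$ if $(H\Rightarrow C\mid B)\in P$, $x=Fv(H)$ and $CT\models d\rightarrow\exists_x((H=H')\wedge C)$. In Simplify and Propagate the program rule is renamed with fresh variables. The data sufficient and qualified answers of $G$ in $P$ are $$\mathcal{SA}_P(G)=\{\exists_{ -Fv(G)}d\mid\langle G,\emptyset,\emptyset\rangle\longrightarrow^*\langle\emptyset,\emptyset,d\rangle\not\longrightarrow\},\quad \mathcal{QA}_P(G)=\{\exists_{ -Fv(G)}(K\wedge d)\mid \langle G,\emptyset,\emptyset\rangle\longrightarrow^*\langle\emptyset,K,d\rangle\not\longrightarrow\}.$$ Answers are read up to logical equivalence under $CT$ with respect to built-in constraints; multiplicity of user-defined constraints matters. A data sufficient answer for the goal $G$ in $P$ is trivial if it is equal to $G$, and non trivial otherwise. **Dialects.** $\mathrm{CHR}_n$ is the CHR language where the number of atoms in the head of each rule is at most $n$. $\mathrm{CHR}_{n,t}$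 consists of the $\mathrm{CHR}_n$ programs which, for any goal, have only trivial data sufficient answers and qualified answers (i.e. no non trivial data sufficient answers). **Acceptable encodings for qualified answers.** For a CHR (sub)language $\mathrm{CHR}_x$ let $\mathcal{P}_x$ be the set of its programs and $\mathcal{G}_x$ the set of its possible goals (the user-defined predicates of source and target languages may differ). An acceptable encoding for qualified answers of $\mathrm{CHR}_x$ into $\mathrm{CHR}_y$ for the class of goals $\mathcal{G}$ is a pair of mappings $[\![\ ]\!]:\mathcal{P}_x\to\mathcal{P}_y$ and $[\![\ ]\!]_g:\mathcal{G}_x\to\mathcal{G}_y$ such that: (1) $\mathcal{P}_x$ and $\mathcal{P}_y$ share the same $CT$; (2) for any goal $(A,B)\in\mathcal{G}_x$, $[\![A,B]\!]_g=[\![A]\!]_g,[\![B]\!]_g$, and the built-ins present in the goal are left unchanged; (3') for all $P\in\mathcal{P}_x$ and $G\in\mathcal{G}$, $\mathcal{QA}_P(G)=\mathcal{QA}_{[\![P]\!]}([\![G]\!]_g)$. -}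

module Defs where

open import Level using (Level; 0ℓ; _⊔_) renaming (suc to lsuc)
open import Data.Bool using (if_then_else_)
open import Data.Empty using (⊥)
open import Data.Unit using (⊤)
open import Data.List using (List; []; _∷_; _++_; map; foldr; filter; length; concatMap)
open import Data.List.NonEmpty as List⁺ using (List⁺)
open import Data.List.Membership.Propositional using (_∈_)
open import Data.List.Relation.Binary.Disjoint.Propositional using (Disjoint)
open import Data.List.Relation.Binary.Permutation.Homogeneous using (Permutation)
open import Data.List.Relation.Binary.Permutation.Propositional using (_↭_)
open import Data.Nat using (ℕ; _≤_; _≟_)
open import Data.Product using (Σ; ∃; ∃-syntax; _×_; _,_; proj₁)
open import Data.Vec using (Vec; []; _∷_)
import Data.Vec as Vec
open import Data.Vec.Relation.Binary.Pointwise.Inductive using (Pointwise)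
open import Function.Definitions using (Injective)
open import Relation.Binary.Construct.Closure.ReflexiveTransitive using (Star)
open import Relation.Binary.PropositionalEquality using (_≡_)
open import Relation.Binary.Structures using (IsEquivalence)
open import Relation.Nullary using (¬_; does; ¬?)
open import Relation.Nullary.Negation using (Stable)
open import Relation.Unary using (Pred)

Var : Set
Var = ℕ

-- The built-in predicates are the symbols of BPred together with equality,
-- which is part of the syntax of built-in constraints below.  UPred is the
-- stock of names from which every language takes its user-defined predicates.
record Signature : Set₁ where
  field
    Fun      : Set
    funArity : Fun → ℕ
    BPred    : Set
    bArity   : BPred → ℕ
    UPred    : Set
    uArity   : UPred → ℕ

module Logic (Sg : Signature) where
  open Signature Sg public

  data Term : Set where
    var : Var → Term
    fun : (f : Fun) → Vec Term (funArity f) → Term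

  data BuiltIn : Set where
    pred : (p : BPred) → Vec Term (bArity p) → BuiltIn
    _≐_  : Term → Term → BuiltIn
    _∧_  : BuiltIn → BuiltIn → BuiltIn
    ex   : Var → BuiltIn → BuiltIn

  data Formula : Set where
    pred        : (p : BPred) → Vec Term (bArity p) → Formula
    _≐_         : Term → Term → Formula
    true false  : Formula
    _∧_ _∨_ _⇒_ : Formula → Formula → Formula
    all ex      : Var → Formula → Formula

  _⇔_ : Formula → Formula → Formula
  φ ⇔ ψ = (φ ⇒ ψ) ∧ (ψ ⇒ φ)

  ⌜_⌝ : BuiltIn → Formula
  ⌜ pred p ts ⌝ = pred p ts
  ⌜ s ≐ t ⌝     = s ≐ t
  ⌜ c ∧ d ⌝     = ⌜ c ⌝ ∧ ⌜ d ⌝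
  ⌜ ex x c ⌝    = ex x ⌜ c ⌝

  ⋀ : List BuiltIn → Formula
  ⋀ = foldr (λ c φ → ⌜ c ⌝ ∧ φ) true

  ex* : List Var → Formula → Formula
  ex* xs φ = foldr ex φ xs

  -- Equality is read as a congruence, i.e. the models are those of the usual
  -- equality axioms.  Atomic facts are stable under double negation so that,
  -- with the clauses for ∨ and ex in Sat, satisfaction is classical.
  record Structure : Set₁ where
    infix 4 _≈_
    field
      Carrier       : Set
      _≈_           : Carrier → Carrier → Set
      isEquivalence : IsEquivalence _≈_
      ≈-stable      : ∀ a b → Stable (a ≈ b)
      ⟦fun⟧         : (f : Fun) → Vec Carrier (funArity f) → Carrier
      ⟦fun⟧-cong    : ∀ f {as bs} → Pointwise _≈_ as bs → ⟦fun⟧ f as ≈ ⟦fun⟧ f bs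
      ⟦pred⟧        : (p : BPred) → Vec Carrier (bArity p) → Set
      ⟦pred⟧-resp   : ∀ p {as bs} → Pointwise _≈_ as bs → ⟦pred⟧ p as → ⟦pred⟧ p bs
      ⟦pred⟧-stable : ∀ p as → Stable (⟦pred⟧ p as)

  module Semantics (M : Structure) where
    open Structure M public

    Assignment : Set
    Assignment = Var → Carrier

    _[_↦_] : Assignment → Var → Carrier → Assignment
    (ρ [ x ↦ a ]) y = if does (y ≟ x) then a else ρ y

    eval  : Assignment → Term → Carrier
    evals : ∀ {k} → Assignment → Vec Term k → Vec Carrier k
    eval ρ (var x)    = ρ x
    eval ρ (fun f ts) = ⟦fun⟧ f (evals ρ ts)
    evals ρ []        = []
    evals ρ (t ∷ ts)  = eval ρ t ∷ evals ρ ts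

    Sat : Formula → Assignment → Set
    Sat (pred p ts) ρ = ⟦pred⟧ p (evals ρ ts)
    Sat (s ≐ t)     ρ = eval ρ s ≈ eval ρ t
    Sat true        ρ = ⊤
    Sat false       ρ = ⊥
    Sat (φ ∧ ψ)     ρ = Sat φ ρ × Sat ψ ρ
    Sat (φ ∨ ψ)     ρ = ¬ (¬ Sat φ ρ × ¬ Sat ψ ρ)
    Sat (φ ⇒ ψ)     ρ = Sat φ ρ → Sat ψ ρ
    Sat (all x φ)   ρ = ∀ a → Sat φ (ρ [ x ↦ a ])
    Sat (ex x φ)    ρ = ¬ (∀ a → ¬ Sat φ (ρ [ x ↦ a ]))

  -- A free variable in an axiom is read as universally quantified.
  Theory : Set₁
  Theory = Pred Formula 0ℓ

  Model : Theory → Structure → Set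
  Model CT M = ∀ φ → CT φ → ∀ ρ → Semantics.Sat M φ ρ

  infix 2 _⊨_
  _⊨_ : Theory → Formula → Set₁
  CT ⊨ φ = ∀ M → Model CT M → ∀ ρ → Semantics.Sat M φ ρ

  remove : Var → List Var → List Var
  remove x = filter (λ y → ¬? (y ≟ x))

  fvTerm  : Term → List Var
  fvTerms : ∀ {k} → Vec Term k → List Var
  fvTerm (var x)     = x ∷ []
  fvTerm (fun f ts)  = fvTerms ts
  fvTerms []         = []
  fvTerms (t ∷ ts)   = fvTerm t ++ fvTerms ts

  fvBuiltIn : BuiltIn → List Var
  fvBuiltIn (pred p ts) = fvTerms ts
  fvBuiltIn (s ≐ t)     = fvTerm s ++ fvTerm t
  fvBuiltIn (c ∧ d)     = fvBuiltIn c ++ fvBuiltIn d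
  fvBuiltIn (ex x c)    = remove x (fvBuiltIn c)

  -- All occurring variables, bound ones included.
  varsBuiltIn : BuiltIn → List Var
  varsBuiltIn (pred p ts) = fvTerms ts
  varsBuiltIn (s ≐ t)     = fvTerm s ++ fvTerm t
  varsBuiltIn (c ∧ d)     = varsBuiltIn c ++ varsBuiltIn d
  varsBuiltIn (ex x c)    = x ∷ varsBuiltIn c

  renTerm  : (Var → Var) → Term → Term
  renTerms : ∀ {k} → (Var → Var) → Vec Term k → Vec Term k
  renTerm π (var x)     = var (π x)
  renTerm π (fun f ts)  = fun f (renTerms π ts)
  renTerms π []         = []
  renTerms π (t ∷ ts)   = renTerm π t ∷ renTerms π ts

  -- Bound variables are renamed too: for an injective π this avoids capture.
  renBuiltIn : (Var → Var) → BuiltIn → BuiltIn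
  renBuiltIn π (pred p ts) = pred p (renTerms π ts)
  renBuiltIn π (s ≐ t)     = renTerm π s ≐ renTerm π t
  renBuiltIn π (c ∧ d)     = renBuiltIn π c ∧ renBuiltIn π d
  renBuiltIn π (ex x c)    = ex (π x) (renBuiltIn π c)

-- The user-defined predicates of one language, as a subset of the common stock.
record Vocabulary (Sg : Signature) : Set₁ where
  field
    Sym            : Set
    name           : Sym → Signature.UPred Sg
    name-injective : Injective _≡_ _≡_ name

-- All languages share the theory CT.
module CHR (Sg : Signature) (CT : Logic.Theory Sg) where
  open Logic Sg public

  module Language (U : Vocabulary Sg) where
    open Vocabulary U public

    record Atom : Set where
      constructor _⦅_⦆
      field
        sym  : Sym
        args : Vec Term (uArity (name sym))

    data Constraint : Set where
      built : BuiltIn → Constraint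
      user  : Atom → Constraint

    -- Lists stand for multisets throughout; they are compared by _↭_.
    Goal : Set
    Goal = List Constraint

    builtPart : Goal → List BuiltIn
    builtPart []            = []
    builtPart (built c ∷ G) = c ∷ builtPart G
    builtPart (user h ∷ G)  = builtPart G

    userPart : Goal → List Atom
    userPart []            = []
    userPart (built c ∷ G) = userPart G
    userPart (user h ∷ G)  = h ∷ userPart G

    data Rule : Set where
      simplification propagation :
        (H : List⁺ Atom) (C : List BuiltIn) (B : Goal) → Rule

    Program : Set
    Program = List Rule

    head : Rule → List Atom
    head (simplification H C B) = List⁺.toList H
    head (propagation H C B)    = List⁺.toList H

    fvAtom : Atom → List Var
    fvAtom (p ⦅ ts ⦆) = fvTerms ts

    fvAtoms : List Atom → List Var
    fvAtoms = concatMap fvAtom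

    fvConstraint : Constraint → List Var
    fvConstraint (built c) = fvBuiltIn c
    fvConstraint (user h)  = fvAtom h

    Fv : Goal → List Var
    Fv = concatMap fvConstraint

    varsConstraint : Constraint → List Var
    varsConstraint (built c) = varsBuiltIn c
    varsConstraint (user h)  = fvAtom h

    vars : Goal → List Var
    vars = concatMap varsConstraint

    varsBuiltIns : List BuiltIn → List Var
    varsBuiltIns = concatMap varsBuiltIn

    varsRule : Rule → List Var
    varsRule (simplification H C B) =
      fvAtoms (List⁺.toList H) ++ varsBuiltIns C ++ vars B
    varsRule (propagation H C B) =
      fvAtoms (List⁺.toList H) ++ varsBuiltIns C ++ vars B

    renAtom : (Var → Var) → Atom → Atom
    renAtom π (p ⦅ ts ⦆) = p ⦅ renTerms π ts ⦆

    renConstraint : (Var → Var) → Constraint → Constraint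
    renConstraint π (built c) = built (renBuiltIn π c)
    renConstraint π (user h)  = user (renAtom π h)

    renRule : (Var → Var) → Rule → Rule
    renRule π (simplification H C B) =
      simplification (List⁺.map (renAtom π) H) (map (renBuiltIn π) C) (map (renConstraint π) B)
    renRule π (propagation H C B) =
      propagation (List⁺.map (renAtom π) H) (map (renBuiltIn π) C) (map (renConstraint π) B)

    -- H ≗ H′ ↝ E : the equation H = H′ is defined and consists of the
    -- equalities E.  Atoms are paired in list order; since Simplify and
    -- Propagate match H′ up to _↭_, every pairing is available.
    infix 4 _≗_↝_
    data _≗_↝_ : List Atom → List Atom → List BuiltIn → Set where
      []  : [] ≗ [] ↝ []
      _∷_ : ∀ {H H′ E p ts} ts′ → H ≗ H′ ↝ E →
            (p ⦅ ts ⦆ ∷ H) ≗ (p ⦅ ts′ ⦆ ∷ H′) ↝ (Vec.toList (Vec.zipWith _≐_ ts ts′) ++ E)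

    record Config : Set where
      constructor ⟨_,_,_⟩
      field
        goal     : Goal
        store    : List Atom
        builtins : List BuiltIn

    varsConfig : Config → List Var
    varsConfig ⟨ G , K , d ⟩ = vars G ++ fvAtoms K ++ varsBuiltIns d

    -- FreshCopy P V c r : r is a variant of a rule of P whose variables occur
    -- neither in V nor in c.
    FreshCopy : Program → List Var → Config → Rule → Set
    FreshCopy P V c r =
      ∃[ r₀ ] ∃[ π ] (r₀ ∈ P × Injective _≡_ _≡_ π × r ≡ renRule π r₀ ×
                      Disjoint (varsRule r) (V ++ varsConfig c))

    -- V holds the variables of the initial goal.  They must be avoided even
    -- when they no longer occur in the configuration (Solve may drop them),
    -- since answers leave the free variables of that goal unquantified.
    data Step (P : Program) (V : List Var) : Config → Config → Set₁ where

      solve : ∀ {G G′ K c d d′} →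
        G ↭ built c ∷ G′ →
        CT ⊨ (⌜ c ⌝ ∧ ⋀ d) ⇔ ⋀ d′ →
        Step P V ⟨ G , K , d ⟩ ⟨ G′ , K , d′ ⟩

      introduce : ∀ {G G′ K h d} →
        G ↭ user h ∷ G′ →
        Step P V ⟨ G , K , d ⟩ ⟨ G′ , h ∷ K , d ⟩

      simplify : ∀ {G K d H C B H′ K′ E} →
        FreshCopy P V ⟨ G , K , d ⟩ (simplification H C B) →
        K ↭ H′ ++ K′ →
        List⁺.toList H ≗ H′ ↝ E →
        CT ⊨ ⋀ d ⇒ ex* (fvAtoms (List⁺.toList H)) (⋀ (E ++ C)) →
        Step P V ⟨ G , K , d ⟩ ⟨ B ++ G , K′ , E ++ d ⟩

      propagate : ∀ {G K d H C B H′ K′ E} →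
        FreshCopy P V ⟨ G , K , d ⟩ (propagation H C B) →
        K ↭ H′ ++ K′ →
        List⁺.toList H ≗ H′ ↝ E →
        CT ⊨ ⋀ d ⇒ ex* (fvAtoms (List⁺.toList H)) (⋀ (E ++ C)) →
        Step P V ⟨ G , K , d ⟩ ⟨ B ++ G , H′ ++ K′ , E ++ d ⟩

    Final : Program → List Var → Config → Set₁
    Final P V c = ∀ c′ → ¬ Step P V c c′

    -- ans V K d is the answer ∃_{-V}(K ∧ d).
    record Answer : Set where
      constructor ans
      field
        free     : List Var
        store    : List Atom
        builtins : List BuiltIn

    data QA (P : Program) (G : Goal) : Pred Answer (lsuc 0ℓ) where
      qualified : ∀ {K d} →
        Star (Step P (vars G)) ⟨ G , [] , [] ⟩ ⟨ [] , K , d ⟩ →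
        Final P (vars G) ⟨ [] , K , d ⟩ →
        QA P G (ans (Fv G) K d)

    data SA (P : Program) (G : Goal) : Pred Answer (lsuc 0ℓ) where
      sufficient : ∀ {d} →
        Star (Step P (vars G)) ⟨ G , [] , [] ⟩ ⟨ [] , [] , d ⟩ →
        Final P (vars G) ⟨ [] , [] , d ⟩ →
        SA P G (ans (Fv G) [] d)

    goalAnswer : Goal → Answer
    goalAnswer G = ans (Fv G) (userPart G) (builtPart G)

  open Language using (Program; Goal; Answer; ans; built; QA; SA)

  module Facts (M : Structure) where
    open Semantics M public

    Fact : Set
    Fact = Σ UPred (λ q → Vec Carrier (uArity q))

    data _≈ᶠ_ : Fact → Fact → Set where
      same : ∀ {q as bs} → Pointwise _≈_ as bs → (q , as) ≈ᶠ (q , bs)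

    _≈ᵐ_ : List Fact → List Fact → Set
    _≈ᵐ_ = Permutation _≈ᶠ_

    AgreeOn : List Var → Assignment → Assignment → Set
    AgreeOn V ρ ρ′ = ∀ x → x ∈ V → ρ′ x ≡ ρ x

    fact : (U : Vocabulary Sg) → Assignment → Language.Atom U → Fact
    fact U ρ (p Language.⦅ ts ⦆) = Language.name U p , evals ρ ts

    facts : (U : Vocabulary Sg) → Assignment → List (Language.Atom U) → List Fact
    facts U ρ = map (fact U ρ)

  -- In a model and under an assignment ρ, the answer ∃_{-V}(K ∧ d) describes
  -- those multisets of user-defined facts that are values of K at some ρ′
  -- agreeing with ρ on V and satisfying d.  Two answers are equal when they
  -- always describe the same multisets; thus built-ins count only up to
  -- CT-equivalence, whereas multiplicities of user-defined facts are kept.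
  Entails : (U W : Vocabulary Sg) → Answer U → Answer W → Set₁
  Entails U W (ans V K d) (ans V′ K′ d′) =
    ∀ M → Model CT M → let open Facts M in
    ∀ ρ ρ₁ → AgreeOn V ρ ρ₁ → Sat (⋀ d) ρ₁ →
    ¬ ¬ (∃[ ρ₂ ] (AgreeOn V′ ρ ρ₂ × Sat (⋀ d′) ρ₂ × facts U ρ₁ K ≈ᵐ facts W ρ₂ K′))

  EqualAnswers : (U W : Vocabulary Sg) → Answer U → Answer W → Set₁
  EqualAnswers U W A A′ = Entails U W A A′ × Entails W U A′ A

  EqualAnswerSets : (U W : Vocabulary Sg) →
                    Pred (Answer U) (lsuc 0ℓ) → Pred (Answer W) (lsuc 0ℓ) → Set₁
  EqualAnswerSets U W 𝒜 ℬ =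
    (∀ A → 𝒜 A → ∃[ B ] (ℬ B × EqualAnswers U W A B)) ×
    (∀ B → ℬ B → ∃[ A ] (𝒜 A × EqualAnswers U W A B))

  CHR[_] : ℕ → (U : Vocabulary Sg) → Pred (Program U) 0ℓ
  CHR[ n ] U P = ∀ r → r ∈ P → length (Language.head U r) ≤ n

  OnlyTrivialSA : (U : Vocabulary Sg) → Pred (Program U) (lsuc 0ℓ)
  OnlyTrivialSA U P =
    ∀ G A → SA U P G A → EqualAnswers U U A (Language.goalAnswer U G)

  CHR[_,t] : ℕ → (U : Vocabulary Sg) → Pred (Program U) (lsuc 0ℓ)
  CHR[ n ,t] U P = CHR[ n ] U P × OnlyTrivialSA U P

  record AcceptableEncodingQA
    {a b ℓ : Level} (U W : Vocabulary Sg)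
    (𝒫x : Pred (Program U) a) (𝒫y : Pred (Program W) b)
    (𝒢 : Pred (Goal U) ℓ) : Set (lsuc 0ℓ ⊔ a ⊔ b ⊔ ℓ) where
    field
      encP      : Σ (Program U) 𝒫x → Σ (Program W) 𝒫y
      encG      : Goal U → Goal W
      encG-resp : ∀ {A B} → A ↭ B → encG A ↭ encG B
      encG-++   : ∀ A B → encG (A ++ B) ↭ encG A ++ encG B
      encG-built : ∀ c → encG (built c ∷ []) ↭ built c ∷ []
      preserves : ∀ P G → 𝒢 G →
        EqualAnswerSets U W (QA U (proj₁ P) G) (QA W (proj₁ (encP P)) (encG G))

  ContainsSubheads : ∀ {a ℓ} (U : Vocabulary Sg) →
                     Pred (Program U) a → Pred (Goal U) ℓ → Set (a ⊔ ℓ)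
  ContainsSubheads U 𝒫 𝒢 =
    ∀ P → 𝒫 P → ∀ r → r ∈ P →
    ∀ K R → Language.head U r ↭ K ++ R → 𝒢 (map Language.user K)

-- Propagation has no history here, so the program with the single rule h, h ⇒ true | true, for a ground
-- atom h, never reaches a final configuration from the goal h, h, whereas h alone is a qualified
-- answer of the goal h.  The program only propagates, so its data sufficient answers are trivial.
-- Under an encoding, h becomes some goal g with a derivation to a final configuration, and h, h
-- becomes g, g.  In a single-headed program that derivation can be run once for each copy of g, with
-- the local variables of the second run renamed apart, and the result is again final.  Hence g, g
-- has a qualified answer, although h, h has none.

module Submission where

open import Defs
open import Level using (Level)
open import Data.Bool using (if_then_else_)
open import Data.List using (List; []; _∷_; [_]; _++_; map; concatMap; length)
open import Data.List.Extrema.Nat using (max; xs≤max)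
open import Data.List.NonEmpty as List⁺ using (List⁺; _∷_)
open import Data.List.Membership.DecPropositional as DecMembership using ()
open import Data.List.Membership.Propositional using (_∈_; _∉_; lose; find)
open import Data.List.Membership.Propositional.Properties
open import Data.List.Properties
  using (map-++; map-∘; map-id; map-id-local; map-cong; ++-assoc; ++-identityʳ; length-map;
         concatMap-++; concatMap-cong; concatMap-map; map-concatMap)
open import Data.List.Relation.Binary.Disjoint.Propositional using (Disjoint)
open import Data.List.Relation.Binary.Permutation.Propositional as ↭
  using (_↭_; ↭-refl; ↭-sym; ↭-trans; ↭-reflexive)
open import Data.List.Relation.Binary.Permutation.Propositional.Properties as Perm
  using (∈-resp-↭; ¬x∷xs↭[]; ↭-empty-inv; ↭-length)
open import Data.List.Relation.Binary.Permutation.Homogeneous as Homogeneous using ()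
open import Data.List.Relation.Binary.Pointwise.Base using ([])
open import Data.List.Relation.Unary.All as All using (All)
open import Data.List.Relation.Unary.Any using (here; there)
open import Data.Nat using (ℕ; _≤_; _<_; _+_; _∸_; _≟_; suc; zero; s≤s)
open import Data.Nat.Properties
  using (≤-trans; m≤m+n; <-irrefl; m+n∸m≡n)
open import Data.Product using (∃; ∃-syntax; _×_; _,_; proj₁; proj₂)
open import Data.Sum using (_⊎_; inj₁; inj₂; [_,_]′)
open import Data.Unit using (tt)
open import Data.Vec as Vec using (Vec; []; _∷_)
open import Data.Vec.Relation.Binary.Pointwise.Inductive as Vecᴾ using (Pointwise; []; _∷_)
open import Function using (_∘_; id)
open import Function.Definitions using (Injective)
open import Relation.Binary.Construct.Closure.ReflexiveTransitive using (Star; ε; _◅_; _◅◅_)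
open import Relation.Binary.PropositionalEquality
  using (_≡_; _≢_; refl; sym; trans; cong; cong₂; subst; subst₂)
open import Relation.Binary.Structures using (IsEquivalence)
open import Relation.Nullary using (¬_; does; yes; no)
open import Relation.Nullary.Decidable using (dec-true; dec-false)
open import Relation.Nullary.Negation using (contradiction)
open import Relation.Unary using (Pred)

-- Renamings that separate variables.

open DecMembership _≟_ using (_∈?_)

-- The left inverse is kept as data because values are later pulled back along it from a renamed
-- copy; `π` need not be onto.
record SeparatingRenaming (V L : List Var) : Set where
  field
    π       : Var → Var
    π⁻¹     : Var → Var
    π⁻¹∘π   : ∀ x → π⁻¹ (π x) ≡ x
    fixes   : ∀ {x} → x ∈ V → π x ≡ x
    avoids  : ∀ {x} → x ∉ V → π x ∉ L

  π-injective : Injective _≡_ _≡_ π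
  π-injective {x} {y} eq = trans (sym (π⁻¹∘π x)) (trans (cong π⁻¹ eq) (π⁻¹∘π y))

∈⇒≤max : ∀ {x} xs → x ∈ xs → x ≤ max 0 xs
∈⇒≤max xs x∈xs = All.lookup (xs≤max 0 xs) x∈xs

-- Variables outside `V` are shifted beyond everything in `V` and `L`, so they meet neither the
-- fixed variables nor `L`.
separatingRenaming : ∀ V L → SeparatingRenaming V L
separatingRenaming V L = record
  { π = π ; π⁻¹ = π⁻¹ ; π⁻¹∘π = inverse ; fixes = fixes ; avoids = avoids }
  where
  N : ℕ
  -- The `suc` matters for the variable 0, whose shift is `N` itself. The default 0 covers the empty
  -- list.
  N = suc (max 0 (V ++ L))

  N+-fresh : ∀ {x} → N + x ∉ V ++ L
  N+-fresh {x} i = <-irrefl refl (≤-trans (s≤s (∈⇒≤max (V ++ L) i)) (m≤m+n N x))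

  π π⁻¹ : Var → Var
  π x = if does (x ∈? V) then x else N + x
  π⁻¹ y = if does (y ∈? V) then y else y ∸ N

  inverse : ∀ x → π⁻¹ (π x) ≡ x
  inverse x with x ∈? V
  inverse x | yes x∈V with x ∈? V
  ... | yes _  = refl
  ... | no x∉V = contradiction x∈V x∉V
  -- A shifted variable lies beyond `V`, so `π⁻¹` always takes it for a shifted one.
  inverse x | no _ with (N + x) ∈? V
  ... | yes i = contradiction (∈-++⁺ˡ i) N+-fresh
  ... | no _  = m+n∸m≡n N x

  fixes : ∀ {x} → x ∈ V → π x ≡ x
  fixes {x} x∈V with x ∈? V
  ... | yes _  = refl
  ... | no x∉V = contradiction x∈V x∉V

  avoids : ∀ {x} → x ∉ V → π x ∉ L
  avoids {x} x∉V i with x ∈? V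
  ... | yes x∈V = x∉V x∈V
  ... | no _    = N+-fresh (∈-++⁺ʳ V i)

-- Renaming of terms and built-in constraints.

module Renaming (Sg : Signature) where
  open Logic Sg

  renTerm-fix : ∀ {π} t → (∀ {x} → x ∈ fvTerm t → π x ≡ x) → renTerm π t ≡ t
  renTerms-fix : ∀ {π k} (ts : Vec Term k) → (∀ {x} → x ∈ fvTerms ts → π x ≡ x) → renTerms π ts ≡ ts
  renTerm-fix (var x) fix = cong var (fix (here refl))
  renTerm-fix (fun f ts) fix = cong (fun f) (renTerms-fix ts fix)
  renTerms-fix [] fix = refl
  renTerms-fix (t ∷ ts) fix =
    cong₂ _∷_ (renTerm-fix t (fix ∘ ∈-++⁺ˡ)) (renTerms-fix ts (fix ∘ ∈-++⁺ʳ (fvTerm t)))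

  renBuiltIn-fix : ∀ {π} c → (∀ {x} → x ∈ varsBuiltIn c → π x ≡ x) → renBuiltIn π c ≡ c
  renBuiltIn-fix (pred p ts) fix = cong (pred p) (renTerms-fix ts fix)
  renBuiltIn-fix (s ≐ t) fix =
    cong₂ _≐_ (renTerm-fix s (fix ∘ ∈-++⁺ˡ)) (renTerm-fix t (fix ∘ ∈-++⁺ʳ (fvTerm s)))
  renBuiltIn-fix (c ∧ d) fix =
    cong₂ _∧_ (renBuiltIn-fix c (fix ∘ ∈-++⁺ˡ)) (renBuiltIn-fix d (fix ∘ ∈-++⁺ʳ (varsBuiltIn c)))
  renBuiltIn-fix (ex x c) fix = cong₂ ex (fix (here refl)) (renBuiltIn-fix c (fix ∘ there))

  renTerm-∘ : ∀ π σ t → renTerm π (renTerm σ t) ≡ renTerm (π ∘ σ) t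
  renTerms-∘ : ∀ {k} π σ (ts : Vec Term k) → renTerms π (renTerms σ ts) ≡ renTerms (π ∘ σ) ts
  renTerm-∘ π σ (var x) = refl
  renTerm-∘ π σ (fun f ts) = cong (fun f) (renTerms-∘ π σ ts)
  renTerms-∘ π σ [] = refl
  renTerms-∘ π σ (t ∷ ts) = cong₂ _∷_ (renTerm-∘ π σ t) (renTerms-∘ π σ ts)

  renBuiltIn-∘ : ∀ π σ c → renBuiltIn π (renBuiltIn σ c) ≡ renBuiltIn (π ∘ σ) c
  renBuiltIn-∘ π σ (pred p ts) = cong (pred p) (renTerms-∘ π σ ts)
  renBuiltIn-∘ π σ (s ≐ t) = cong₂ _≐_ (renTerm-∘ π σ s) (renTerm-∘ π σ t)
  renBuiltIn-∘ π σ (c ∧ d) = cong₂ _∧_ (renBuiltIn-∘ π σ c) (renBuiltIn-∘ π σ d)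
  renBuiltIn-∘ π σ (ex x c) = cong (ex (π (σ x))) (renBuiltIn-∘ π σ c)

  map-++-cong : ∀ π {xs ys xs′ ys′ : List Var} → xs ≡ map π xs′ → ys ≡ map π ys′ →
                xs ++ ys ≡ map π (xs′ ++ ys′)
  map-++-cong π {xs′ = xs′} {ys′} p q = trans (cong₂ _++_ p q) (sym (map-++ π xs′ ys′))

  fvTerm-ren : ∀ π t → fvTerm (renTerm π t) ≡ map π (fvTerm t)
  fvTerms-ren : ∀ {k} π (ts : Vec Term k) → fvTerms (renTerms π ts) ≡ map π (fvTerms ts)
  fvTerm-ren π (var x) = refl
  fvTerm-ren π (fun f ts) = fvTerms-ren π ts
  fvTerms-ren π [] = refl
  fvTerms-ren π (t ∷ ts) = map-++-cong π (fvTerm-ren π t) (fvTerms-ren π ts)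

  varsBuiltIn-ren : ∀ π c → varsBuiltIn (renBuiltIn π c) ≡ map π (varsBuiltIn c)
  varsBuiltIn-ren π (pred p ts) = fvTerms-ren π ts
  varsBuiltIn-ren π (s ≐ t) = map-++-cong π (fvTerm-ren π s) (fvTerm-ren π t)
  varsBuiltIn-ren π (c ∧ d) = map-++-cong π (varsBuiltIn-ren π c) (varsBuiltIn-ren π d)
  varsBuiltIn-ren π (ex x c) = cong (π x ∷_) (varsBuiltIn-ren π c)

  concatMap-ren : ∀ {A : Set} π {r : A → A} {f : A → List Var} → (∀ x → f (r x) ≡ map π (f x)) →
                  ∀ xs → concatMap f (map r xs) ≡ map π (concatMap f xs)
  concatMap-ren π {r} {f} eq xs =
    trans (concatMap-map f r xs) (trans (concatMap-cong eq xs) (sym (map-concatMap π f xs)))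

  zipWith-≐-ren : ∀ {k} π (ts ts′ : Vec Term k) →
    Vec.toList (Vec.zipWith _≐_ (renTerms π ts) (renTerms π ts′)) ≡
    map (renBuiltIn π) (Vec.toList (Vec.zipWith _≐_ ts ts′))
  zipWith-≐-ren π [] [] = refl
  zipWith-≐-ren π (t ∷ ts) (t′ ∷ ts′) = cong (_ ∷_) (zipWith-≐-ren π ts ts′)

  -- Satisfaction under renaming.

  module Satisfaction (M : Structure) where
    open Semantics M

    Agree : (Var → Var) → List Var → Assignment → Assignment → Set
    Agree π S ρ ρ′ = ∀ {x} → x ∈ S → ρ′ (π x) ≡ ρ x

    eval-ren : ∀ {π ρ ρ′} t → Agree π (fvTerm t) ρ ρ′ → eval ρ′ (renTerm π t) ≡ eval ρ t
    evals-ren : ∀ {π ρ ρ′ k} (ts : Vec Term k) → Agree π (fvTerms ts) ρ ρ′ →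
                evals ρ′ (renTerms π ts) ≡ evals ρ ts
    eval-ren (var x) agr = agr (here refl)
    eval-ren (fun f ts) agr = cong (⟦fun⟧ f) (evals-ren ts agr)
    evals-ren [] agr = refl
    evals-ren (t ∷ ts) agr =
      cong₂ _∷_ (eval-ren t (agr ∘ ∈-++⁺ˡ)) (evals-ren ts (agr ∘ ∈-++⁺ʳ (fvTerm t)))

    update-same : ∀ ρ x a → (ρ [ x ↦ a ]) x ≡ a
    update-same ρ x a rewrite dec-true (x ≟ x) refl = refl

    update-other : ∀ ρ {x y} a → y ≢ x → (ρ [ x ↦ a ]) y ≡ ρ y
    update-other ρ {x} {y} a y≢x rewrite dec-false (y ≟ x) y≢x = refl

    -- Injectivity keeps an update at `π x` from disturbing the image of any other variable.
    update-agree : ∀ {π ρ ρ′ S} → Injective _≡_ _≡_ π → ∀ x a → Agree π S ρ ρ′ →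
                   Agree π S (ρ [ x ↦ a ]) (ρ′ [ π x ↦ a ])
    update-agree {π} {ρ} {ρ′} inj x a agr {y} i with y ≟ x
    ... | yes refl = trans (update-same ρ′ (π x) a) (sym (update-same ρ x a))
    ... | no y≢x   =
      trans (update-other ρ′ a (y≢x ∘ inj)) (trans (agr i) (sym (update-other ρ a y≢x)))

    -- Agreement is asked for on bound variables too: after `update-agree`, the hypothesis for
    -- `ex x c` is then the one for its body. As `ex` is read as `¬ ∀ ¬`, each direction follows
    -- from the same direction for the body.
    Sat-ren : ∀ {π} → Injective _≡_ _≡_ π → ∀ c {ρ ρ′} → Agree π (varsBuiltIn c) ρ ρ′ →
              (Sat ⌜ renBuiltIn π c ⌝ ρ′ → Sat ⌜ c ⌝ ρ) × (Sat ⌜ c ⌝ ρ → Sat ⌜ renBuiltIn π c ⌝ ρ′)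
    Sat-ren {π} inj (pred p ts) {ρ} {ρ′} agr rewrite evals-ren {π} {ρ} {ρ′} ts agr = id , id
    Sat-ren {π} inj (s ≐ t) {ρ} {ρ′} agr
      rewrite eval-ren {π} {ρ} {ρ′} s (agr ∘ ∈-++⁺ˡ)
            | eval-ren {π} {ρ} {ρ′} t (agr ∘ ∈-++⁺ʳ (fvTerm s)) = id , id
    Sat-ren inj (c ∧ d) agr
      with c⇒ , c⇐ ← Sat-ren inj c (agr ∘ ∈-++⁺ˡ)
         | d⇒ , d⇐ ← Sat-ren inj d (agr ∘ ∈-++⁺ʳ (varsBuiltIn c))
      = (λ (s , t) → c⇒ s , d⇒ t) , (λ (s , t) → c⇐ s , d⇐ t)
    Sat-ren {π} inj (ex x c) {ρ} {ρ′} agr =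
      (λ s k → s λ a t → k a (proj₁ (body a) t)) , (λ s k → s λ a t → k a (proj₂ (body a) t))
      where
      body : ∀ a → (Sat ⌜ renBuiltIn π c ⌝ (ρ′ [ π x ↦ a ]) → Sat ⌜ c ⌝ (ρ [ x ↦ a ])) ×
                   (Sat ⌜ c ⌝ (ρ [ x ↦ a ]) → Sat ⌜ renBuiltIn π c ⌝ (ρ′ [ π x ↦ a ]))
      body a = Sat-ren inj c (update-agree {ρ = ρ} {ρ′} inj x a (agr ∘ there))

    ⋀-ren : ∀ {π} → Injective _≡_ _≡_ π → ∀ cs {ρ ρ′} → Agree π (concatMap varsBuiltIn cs) ρ ρ′ →
            (Sat (⋀ (map (renBuiltIn π) cs)) ρ′ → Sat (⋀ cs) ρ) ×
            (Sat (⋀ cs) ρ → Sat (⋀ (map (renBuiltIn π) cs)) ρ′)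
    ⋀-ren inj [] agr = id , id
    ⋀-ren inj (c ∷ cs) agr
      with c⇒ , c⇐ ← Sat-ren inj c (agr ∘ ∈-++⁺ˡ)
         | cs⇒ , cs⇐ ← ⋀-ren inj cs (agr ∘ ∈-++⁺ʳ (varsBuiltIn c))
      = (λ (s , t) → c⇒ s , cs⇒ t) , (λ (s , t) → c⇐ s , cs⇐ t)

    ⋀-cong : ∀ cs {ρ ρ′} → (∀ {x} → x ∈ concatMap varsBuiltIn cs → ρ′ x ≡ ρ x) →
             Sat (⋀ cs) ρ → Sat (⋀ cs) ρ′
    ⋀-cong cs {ρ} {ρ′} agr s =
      subst (λ ds → Sat (⋀ ds) ρ′)
        (map-id-local {f = renBuiltIn id} {xs = cs} (All.tabulate λ {c} _ → renBuiltIn-fix c λ _ → refl))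
        (proj₂ (⋀-ren id cs agr) s)

    evals-cong : ∀ {ρ ρ′ k} (ts : Vec Term k) → (∀ {x} → x ∈ fvTerms ts → ρ′ x ≡ ρ x) →
                 evals ρ′ ts ≡ evals ρ ts
    evals-cong {ρ} {ρ′} ts agr =
      trans (cong (evals ρ′) (sym (renTerms-fix ts λ _ → refl))) (evals-ren {id} ts agr)

    ≐⇒Pointwise : ∀ {k ρ} (ts us : Vec Term k) {cs} →
      Sat (⋀ (Vec.toList (Vec.zipWith _≐_ ts us) ++ cs)) ρ →
      Pointwise _≈_ (evals ρ ts) (evals ρ us) × Sat (⋀ cs) ρ
    ≐⇒Pointwise [] [] s = [] , s
    ≐⇒Pointwise (t ∷ ts) (u ∷ us) (e , s) with es , s′ ← ≐⇒Pointwise ts us s = e ∷ es , s′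

    Pointwise⇒≐ : ∀ {k ρ} (ts us : Vec Term k) {cs} →
      Pointwise _≈_ (evals ρ ts) (evals ρ us) → Sat (⋀ cs) ρ →
      Sat (⋀ (Vec.toList (Vec.zipWith _≐_ ts us) ++ cs)) ρ
    Pointwise⇒≐ [] [] [] s = s
    Pointwise⇒≐ (t ∷ ts) (u ∷ us) (e ∷ es) s = e , Pointwise⇒≐ ts us es s

    ⋀-++⁺ : ∀ cs {ds ρ} → Sat (⋀ cs) ρ → Sat (⋀ ds) ρ → Sat (⋀ (cs ++ ds)) ρ
    ⋀-++⁺ [] _ t = t
    ⋀-++⁺ (c ∷ cs) (s , ss) t = s , ⋀-++⁺ cs ss t

    ⋀-++⁻ : ∀ cs {ds ρ} → Sat (⋀ (cs ++ ds)) ρ → Sat (⋀ cs) ρ × Sat (⋀ ds) ρ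
    ⋀-++⁻ [] t = tt , t
    ⋀-++⁻ (c ∷ cs) (s , t) with ss , u ← ⋀-++⁻ cs t = (s , ss) , u

    -- A simulation argument in which `R` only has to survive parallel updates of the quantified
    -- variables. It serves with `f = π` to rename a guard, and with `f = id` to exchange the atom
    -- that a head is matched with.
    ex*-transport : ∀ {φ ψ} f (R : Assignment → Assignment → Set) xs →
      (∀ {x ρ ρ′} a → x ∈ xs → R ρ ρ′ → R (ρ [ x ↦ a ]) (ρ′ [ f x ↦ a ])) →
      (∀ {ρ ρ′} → R ρ ρ′ → Sat φ ρ → Sat ψ ρ′) →
      ∀ {ρ ρ′} → R ρ ρ′ → Sat (ex* xs φ) ρ → Sat (ex* (map f xs) ψ) ρ′
    ex*-transport f R [] upd imp r s = imp r s
    ex*-transport f R (x ∷ xs) upd imp r s k = s λ a t →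
      k a (ex*-transport f R xs (λ b i → upd b (there i)) imp (upd a (here refl) r) t)

-- Renaming of atoms, goals and rules.

module Operational (Sg : Signature) (CT : Logic.Theory Sg) (U : Vocabulary Sg) where
  open CHR Sg CT
  open Language U
  open Renaming Sg

  concatMap-⊆ : ∀ {A : Set} (f : A → List Var) as bs → (∀ {a} → a ∈ as → a ∈ bs) →
                ∀ {x} → x ∈ concatMap f as → x ∈ concatMap f bs
  concatMap-⊆ f as bs sub i with a , a∈as , x∈fa ← find (∈-concatMap⁻ f {xs = as} i) =
    ∈-concatMap⁺ f (lose (sub a∈as) x∈fa)

  renAtom-fix : ∀ {π} h → (∀ {x} → x ∈ fvAtom h → π x ≡ x) → renAtom π h ≡ h
  renAtom-fix (p ⦅ ts ⦆) fix = cong (p ⦅_⦆) (renTerms-fix ts fix)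

  renConstraint-fix : ∀ {π} c → (∀ {x} → x ∈ varsConstraint c → π x ≡ x) → renConstraint π c ≡ c
  renConstraint-fix (built c) fix = cong built (renBuiltIn-fix c fix)
  renConstraint-fix (user h) fix = cong user (renAtom-fix h fix)

  map-fix : ∀ {A : Set} (f : A → List Var) (ren : (Var → Var) → A → A) →
    (∀ {π} a → (∀ {x} → x ∈ f a → π x ≡ x) → ren π a ≡ a) →
    ∀ {π} as → (∀ {x} → x ∈ concatMap f as → π x ≡ x) → map (ren π) as ≡ as
  map-fix f ren ren-fix {π} as fix = map-id-local (All.tabulate λ {a} a∈as →
    ren-fix {π} a λ x∈fa → fix (∈-concatMap⁺ f (lose a∈as x∈fa)))

  renAtom-∘ : ∀ π σ h → renAtom π (renAtom σ h) ≡ renAtom (π ∘ σ) h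
  renAtom-∘ π σ (p ⦅ ts ⦆) = cong (p ⦅_⦆) (renTerms-∘ π σ ts)

  renConstraint-∘ : ∀ π σ c → renConstraint π (renConstraint σ c) ≡ renConstraint (π ∘ σ) c
  renConstraint-∘ π σ (built c) = cong built (renBuiltIn-∘ π σ c)
  renConstraint-∘ π σ (user h) = cong user (renAtom-∘ π σ h)

  map-ren-∘ : ∀ {A : Set} (ren : (Var → Var) → A → A) →
    (∀ π σ a → ren π (ren σ a) ≡ ren (π ∘ σ) a) →
    ∀ π σ as → map (ren π) (map (ren σ) as) ≡ map (ren (π ∘ σ)) as
  map-ren-∘ ren ren-∘ π σ as = trans (sym (map-∘ as)) (map-cong (ren-∘ π σ) as)

  renRule-∘ : ∀ π σ r → renRule π (renRule σ r) ≡ renRule (π ∘ σ) r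
  renRule-∘ π σ (simplification (h ∷ H) C B)
    rewrite renAtom-∘ π σ h | map-ren-∘ renAtom renAtom-∘ π σ H
          | map-ren-∘ renBuiltIn renBuiltIn-∘ π σ C
          | map-ren-∘ renConstraint renConstraint-∘ π σ B = refl
  renRule-∘ π σ (propagation (h ∷ H) C B)
    rewrite renAtom-∘ π σ h | map-ren-∘ renAtom renAtom-∘ π σ H
          | map-ren-∘ renBuiltIn renBuiltIn-∘ π σ C
          | map-ren-∘ renConstraint renConstraint-∘ π σ B = refl

  fvAtom-ren : ∀ π h → fvAtom (renAtom π h) ≡ map π (fvAtom h)
  fvAtom-ren π (p ⦅ ts ⦆) = fvTerms-ren π ts

  varsConstraint-ren : ∀ π c → varsConstraint (renConstraint π c) ≡ map π (varsConstraint c)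
  varsConstraint-ren π (built c) = varsBuiltIn-ren π c
  varsConstraint-ren π (user h) = fvAtom-ren π h

  fvAtoms-ren : ∀ π K → fvAtoms (map (renAtom π) K) ≡ map π (fvAtoms K)
  fvAtoms-ren π = concatMap-ren π (fvAtom-ren π)

  varsBuiltIns-ren : ∀ π d → varsBuiltIns (map (renBuiltIn π) d) ≡ map π (varsBuiltIns d)
  varsBuiltIns-ren π = concatMap-ren π (varsBuiltIn-ren π)

  vars-ren : ∀ π G → vars (map (renConstraint π) G) ≡ map π (vars G)
  vars-ren π = concatMap-ren π (varsConstraint-ren π)

  varsRule-ren : ∀ π r → varsRule (renRule π r) ≡ map π (varsRule r)
  varsRule-ren π (simplification H C B) =
    map-++-cong π (fvAtoms-ren π (List⁺.toList H)) (map-++-cong π (varsBuiltIns-ren π C) (vars-ren π B))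
  varsRule-ren π (propagation H C B) =
    map-++-cong π (fvAtoms-ren π (List⁺.toList H)) (map-++-cong π (varsBuiltIns-ren π C) (vars-ren π B))

  ≗-ren : ∀ π {H H′ E} → H ≗ H′ ↝ E →
          map (renAtom π) H ≗ map (renAtom π) H′ ↝ map (renBuiltIn π) E
  ≗-ren π [] = []
  ≗-ren π (_∷_ {E = E} {ts = ts} ts′ eqs) =
    subst (_ ≗ _ ↝_)
      (trans (cong (_++ _) (zipWith-≐-ren π ts ts′)) (sym (map-++ (renBuiltIn π) _ E)))
      (renTerms π ts′ ∷ ≗-ren π eqs)

  map-++-assoc : ∀ {A B : Set} (f : A → B) xs ys zs →
                 map f xs ++ (map f ys ++ zs) ≡ map f (xs ++ ys) ++ zs
  map-++-assoc f xs ys zs =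
    trans (sym (++-assoc (map f xs) (map f ys) zs)) (cong (_++ zs) (sym (map-++ f xs ys)))

  -- Replaying a derivation, renamed, inside a larger configuration.

  module Simulation
    (Q : Program) (V V′ : List Var) (π : Var → Var) (inj : Injective _≡_ _≡_ π)
    (R : Goal) (K₀ : List Atom) (d₀ : List BuiltIn)
    (avoid : ∀ {x} → x ∉ V → π x ∉ V′ ++ varsConfig ⟨ R , K₀ , d₀ ⟩)
    where

    -- `R`, `K₀` and `d₀` are a context that the replayed derivation never touches. The goal is
    -- tracked only up to permutation, because the initial goal is known only up to permutation.
    record Embeds (c ĉ : Config) : Set where
      constructor embeds
      field
        goal-↭     : Config.goal ĉ ↭ map (renConstraint π) (Config.goal c) ++ R
        store-≡    : Config.store ĉ ≡ map (renAtom π) (Config.store c) ++ K₀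
        builtins-≡ : Config.builtins ĉ ≡ map (renBuiltIn π) (Config.builtins c) ++ d₀

    concatMap-split : ∀ {A : Set} {f : A → List Var} {r : A → A} → (∀ a → f (r a) ≡ map π (f a)) →
      ∀ as {bs} {v} → v ∈ concatMap f (map r as ++ bs) → v ∈ map π (concatMap f as) ⊎ v ∈ concatMap f bs
    concatMap-split {f = f} {r} eq as {bs} i
      with ∈-++⁻ (concatMap f (map r as)) (subst (_ ∈_) (concatMap-++ f (map r as) bs) i)
    ... | inj₁ j = inj₁ (subst (_ ∈_) (concatMap-ren π eq as) j)
    ... | inj₂ j = inj₂ j

    varsConfig-split : ∀ {c ĉ v} → Embeds c ĉ → v ∈ varsConfig ĉ →
                       v ∈ map π (varsConfig c) ⊎ v ∈ varsConfig ⟨ R , K₀ , d₀ ⟩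
    varsConfig-split {⟨ G , K , d ⟩} {⟨ Ĝ , K̂ , d̂ ⟩} {v} (embeds p refl refl) i
      rewrite map-++ π (vars G) (fvAtoms K ++ varsBuiltIns d) | map-++ π (fvAtoms K) (varsBuiltIns d)
      with ∈-++⁻ (vars Ĝ) i
    ... | inj₁ j with concatMap-split (varsConstraint-ren π) G
                        (concatMap-⊆ varsConstraint Ĝ _ (∈-resp-↭ p) j)
    ...   | inj₁ k = inj₁ (∈-++⁺ˡ k)
    ...   | inj₂ k = inj₂ (∈-++⁺ˡ k)
    varsConfig-split {⟨ G , K , d ⟩} {⟨ Ĝ , K̂ , d̂ ⟩} {v} (embeds p refl refl) i | inj₂ j
      with ∈-++⁻ (fvAtoms K̂) j
    ... | inj₁ k with concatMap-split (fvAtom-ren π) K k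
    ...   | inj₁ l = inj₁ (∈-++⁺ʳ (map π (vars G)) (∈-++⁺ˡ l))
    ...   | inj₂ l = inj₂ (∈-++⁺ʳ (vars R) (∈-++⁺ˡ l))
    varsConfig-split {⟨ G , K , d ⟩} {⟨ Ĝ , K̂ , d̂ ⟩} {v} (embeds p refl refl) i | inj₂ j | inj₂ k
      with concatMap-split (varsBuiltIn-ren π) d k
    ... | inj₁ l = inj₁ (∈-++⁺ʳ (map π (vars G)) (∈-++⁺ʳ (map π (fvAtoms K)) l))
    ... | inj₂ l = inj₂ (∈-++⁺ʳ (vars R) (∈-++⁺ʳ (fvAtoms K₀) l))

    -- A variable of the renamed rule is `π x` with `x` in the rule, hence outside `V`. Then `avoid`
    -- keeps it out of `V′` and of the context, and injectivity keeps it out of the image of `c`.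
    fresh-ren : ∀ {c ĉ r} → Embeds c ĉ → FreshCopy Q V c r → FreshCopy Q V′ ĉ (renRule π r)
    fresh-ren {c} {ĉ} {r} emb (r₀ , σ , r₀∈Q , σ-inj , refl , disj) =
      r₀ , π ∘ σ , r₀∈Q , σ-inj ∘ inj , renRule-∘ π σ r₀ , disj′
      where
      disj′ : Disjoint (varsRule (renRule π r)) (V′ ++ varsConfig ĉ)
      disj′ {v} (i , j)
        with x , x∈r , refl ← ∈-map⁻ π (subst (v ∈_) (varsRule-ren π r) i)
        with ∈-++⁻ V′ j
      ... | inj₁ k = avoid (λ x∈V → disj (x∈r , ∈-++⁺ˡ x∈V)) (∈-++⁺ˡ k)
      ... | inj₂ k with varsConfig-split emb k
      ...   | inj₂ l = avoid (λ x∈V → disj (x∈r , ∈-++⁺ˡ x∈V)) (∈-++⁺ʳ V′ l)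
      ...   | inj₁ l with y , y∈c , eq ← ∈-map⁻ π l with refl ← inj eq =
        disj (x∈r , ∈-++⁺ʳ V y∈c)

    -- An assignment `ρ` reads the renamed constraints as `ρ ∘ π` reads the originals; `d₀` is
    -- carried along on both sides.
    solve-ren : ∀ c d d′ → CT ⊨ (⌜ c ⌝ ∧ ⋀ d) ⇔ ⋀ d′ →
      CT ⊨ (⌜ renBuiltIn π c ⌝ ∧ ⋀ (map (renBuiltIn π) d ++ d₀)) ⇔ ⋀ (map (renBuiltIn π) d′ ++ d₀)
    solve-ren c d d′ eqv M mod ρ =
      (λ (s , t) → let t₁ , t₂ = ⋀-++⁻ (map (renBuiltIn π) d) t in
        ⋀-++⁺ (map (renBuiltIn π) d′)
          (proj₂ ⋀d′ (proj₁ (eqv M mod (ρ ∘ π)) (proj₁ ⌜c⌝ s , proj₁ ⋀d t₁))) t₂) ,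
      (λ t → let t₁ , t₂ = ⋀-++⁻ (map (renBuiltIn π) d′) t
                 s , u = proj₂ (eqv M mod (ρ ∘ π)) (proj₁ ⋀d′ t₁) in
        proj₂ ⌜c⌝ s , ⋀-++⁺ (map (renBuiltIn π) d) (proj₂ ⋀d u) t₂)
      where
      open Satisfaction M
      ⌜c⌝ = Sat-ren inj c {ρ ∘ π} {ρ} (λ _ → refl)
      ⋀d  = ⋀-ren inj d {ρ ∘ π} {ρ} (λ _ → refl)
      ⋀d′ = ⋀-ren inj d′ {ρ ∘ π} {ρ} (λ _ → refl)

    -- The context `d₀` only strengthens the premise, and the original guard is used at `ρ ∘ π`.
    guard-ren : ∀ H E C d → CT ⊨ ⋀ d ⇒ ex* (fvAtoms H) (⋀ (E ++ C)) →
      CT ⊨ ⋀ (map (renBuiltIn π) d ++ d₀) ⇒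
        ex* (fvAtoms (map (renAtom π) H)) (⋀ (map (renBuiltIn π) E ++ map (renBuiltIn π) C))
    guard-ren H E C d grd M mod ρ s =
      subst₂ (λ xs cs → Semantics.Sat M (ex* xs (⋀ cs)) ρ)
        (sym (fvAtoms-ren π H)) (map-++ (renBuiltIn π) E C)
        (ex*-transport {⋀ (E ++ C)} {⋀ (map (renBuiltIn π) (E ++ C))} π
          (Agree π (varsBuiltIns (E ++ C))) (fvAtoms H)
          (λ {x} {ρ₁} {ρ₂} a _ agr i → update-agree {π} {ρ₁} {ρ₂} inj x a agr i)
          (λ agr → proj₂ (⋀-ren inj (E ++ C) agr))
          (λ _ → refl)
          (grd M mod (ρ ∘ π) (proj₁ (⋀-ren inj d (λ _ → refl)) (proj₁ (⋀-++⁻ (map (renBuiltIn π) d) s)))))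
      where open Satisfaction M

    store-ren : ∀ {K H′} K′ → K ↭ H′ ++ K′ →
      map (renAtom π) K ++ K₀ ↭ map (renAtom π) H′ ++ (map (renAtom π) K′ ++ K₀)
    store-ren {H′ = H′} K′ p = ↭-trans (Perm.++⁺ʳ K₀ (Perm.map⁺ (renAtom π) p))
      (↭-reflexive (sym (map-++-assoc (renAtom π) H′ K′ K₀)))

    body-ren : ∀ {G Ĝ} B → Ĝ ↭ map (renConstraint π) G ++ R →
      map (renConstraint π) B ++ Ĝ ↭ map (renConstraint π) (B ++ G) ++ R
    body-ren {G} B p = ↭-trans (Perm.++⁺ˡ (map (renConstraint π) B) p)
      (↭-reflexive (map-++-assoc (renConstraint π) B G R))

    step-ren : ∀ {c c₁ ĉ} → Embeds c ĉ → Step Q V c c₁ → ∃ λ ĉ₁ → Step Q V′ ĉ ĉ₁ × Embeds c₁ ĉ₁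
    step-ren (embeds p refl refl) (solve {c = c} {d} {d′} q eqv) =
      _ , solve (↭-trans p (Perm.++⁺ʳ R (Perm.map⁺ (renConstraint π) q))) (solve-ren c d d′ eqv) ,
      embeds ↭-refl refl refl
    step-ren (embeds p refl refl) (introduce q) =
      _ , introduce (↭-trans p (Perm.++⁺ʳ R (Perm.map⁺ (renConstraint π) q))) ,
      embeds ↭-refl refl refl
    step-ren emb@(embeds p refl refl) (simplify {d = d} {H = H} {C} {B} {K′ = K′} {E} fr q eqs grd) =
      _ , simplify (fresh-ren emb fr) (store-ren K′ q) (≗-ren π eqs) (guard-ren (List⁺.toList H) E C d grd) ,
      embeds (body-ren B p) refl (map-++-assoc (renBuiltIn π) E d d₀)
    step-ren emb@(embeds p refl refl)
      (propagate {d = d} {H = H} {C} {B} {H′} {K′} {E} fr q eqs grd) =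
      _ , propagate (fresh-ren emb fr) (store-ren K′ q) (≗-ren π eqs) (guard-ren (List⁺.toList H) E C d grd) ,
      embeds (body-ren B p) (map-++-assoc (renAtom π) H′ K′ K₀) (map-++-assoc (renBuiltIn π) E d d₀)

    steps-ren : ∀ {c c₁ ĉ} → Embeds c ĉ → Star (Step Q V) c c₁ →
                ∃ λ ĉ₁ → Star (Step Q V′) ĉ ĉ₁ × Embeds c₁ ĉ₁
    steps-ren emb ε = _ , ε , emb
    steps-ren emb (s ◅ ss)
      with _ , ŝ , emb′ ← step-ren emb s
      with _ , ŝs , emb″ ← steps-ren emb′ ss = _ , ŝ ◅ ŝs , emb″

  -- Finality of two copies of a final configuration, for single-headed programs.

  ∈⇒↭ : ∀ {A : Set} {a : A} {as} → a ∈ as → ∃ λ bs → as ↭ a ∷ bs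
  ∈⇒↭ {a = a} a∈as with bs , cs , refl ← ∈-∃++ a∈as = bs ++ cs , Perm.shift a bs cs

  renRule-head : ∀ π r → length (head (renRule π r)) ≡ length (head r)
  renRule-head π (simplification (h ∷ H) C B) = cong suc (length-map (renAtom π) H)
  renRule-head π (propagation (h ∷ H) C B) = cong suc (length-map (renAtom π) H)

  -- A rule firing on an atom of either copy already fires on that atom in a single copy: every
  -- solution of one copy of d extends to the renamed copy, so the latter adds nothing to the guard.
  module Doubling
    (Q : Program) (single : CHR[ 1 ] U Q)
    (V V′ : List Var) (V⊆V′ : ∀ {x} → x ∈ V → x ∈ V′)
    (K : List Atom) (d : List BuiltIn) (final : Final Q V ⟨ [] , K , d ⟩)
    (ren : SeparatingRenaming V (V′ ++ varsConfig ⟨ [] , K , d ⟩))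
    where
    open SeparatingRenaming ren

    S : List Var
    S = fvAtoms K ++ varsBuiltIns d

    double : Config
    double = ⟨ [] , map (renAtom π) K ++ K , map (renBuiltIn π) d ++ d ⟩

    ∈-concatMap-++ʳ : ∀ {A : Set} (f : A → List Var) as {bs x} →
                      x ∈ concatMap f bs → x ∈ concatMap f (as ++ bs)
    ∈-concatMap-++ʳ f as {bs} = concatMap-⊆ f bs (as ++ bs) (∈-++⁺ʳ as)

    ∈-concatMap-++ˡ : ∀ {A : Set} (f : A → List Var) as {bs x} →
                      x ∈ concatMap f as → x ∈ concatMap f (as ++ bs)
    ∈-concatMap-++ˡ f as {bs} = concatMap-⊆ f as (as ++ bs) ∈-++⁺ˡ

    S⊆double : ∀ {x} → x ∈ S → x ∈ varsConfig double
    S⊆double i with ∈-++⁻ (fvAtoms K) i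
    ... | inj₁ j = ∈-++⁺ˡ (∈-concatMap-++ʳ fvAtom (map (renAtom π) K) j)
    ... | inj₂ j = ∈-++⁺ʳ (fvAtoms (map (renAtom π) K ++ K))
                     (∈-concatMap-++ʳ varsBuiltIn (map (renBuiltIn π) d) j)

    πS⊆double : ∀ {x} → x ∈ S → π x ∈ varsConfig double
    πS⊆double i with ∈-++⁻ (fvAtoms K) i
    ... | inj₁ j = ∈-++⁺ˡ (∈-concatMap-++ˡ fvAtom (map (renAtom π) K)
                     (subst (_ ∈_) (sym (fvAtoms-ren π K)) (∈-map⁺ π j)))
    ... | inj₂ j = ∈-++⁺ʳ (fvAtoms (map (renAtom π) K ++ K))
                     (∈-concatMap-++ˡ varsBuiltIn (map (renBuiltIn π) d)
                       (subst (_ ∈_) (sym (varsBuiltIns-ren π d)) (∈-map⁺ π j)))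

    fresh-single : ∀ {r} → FreshCopy Q V′ double r → FreshCopy Q V ⟨ [] , K , d ⟩ r
    fresh-single (r₀ , σ , r₀∈Q , σ-inj , eq , disj) = r₀ , σ , r₀∈Q , σ-inj , eq , disj′
      where
      disj′ : Disjoint _ (V ++ S)
      disj′ (i , j) with ∈-++⁻ V j
      ... | inj₁ k = disj (i , ∈-++⁺ˡ (V⊆V′ k))
      ... | inj₂ k = disj (i , ∈-++⁺ʳ V′ (S⊆double k))

    module Extension (M : Structure) where
      open Satisfaction M
      open Semantics M

      -- Turns a solution of `d` into a common solution of both copies, by giving variables of the
      -- renamed copy the values of their originals.
      extend : Assignment → Assignment
      extend ρ y = if does (y ∈? map π S) then ρ (π⁻¹ y) else ρ y

      extend-other : ∀ ρ {y} → y ∉ map π S → extend ρ y ≡ ρ y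
      extend-other ρ {y} y∉ rewrite dec-false (y ∈? map π S) y∉ = refl

      extend-copy : ∀ ρ {x} → x ∈ S → extend ρ (π x) ≡ ρ x
      extend-copy ρ {x} x∈S rewrite dec-true (π x ∈? map π S) (∈-map⁺ π x∈S) = cong ρ (π⁻¹∘π x)

      -- The two copies share only variables of `V`, which `π` fixes, since the image of any other
      -- variable avoids `S`. Hence the two readings never conflict.
      extend-original : ∀ ρ {x} → x ∈ S → extend ρ x ≡ ρ x
      extend-original ρ {x} x∈S with x ∈? V
      ... | yes x∈V = trans (cong (extend ρ) (sym (fixes x∈V))) (extend-copy ρ x∈S)
      ... | no x∉V  = extend-other ρ x∉πS
        where
        x∉πS : x ∉ map π S
        x∉πS i with y , y∈S , x≡πy ← ∈-map⁻ π i with y ∈? V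
        ... | yes y∈V = x∉V (subst (_∈ V) (sym (trans x≡πy (fixes y∈V))) y∈V)
        ... | no y∉V  = avoids y∉V (∈-++⁺ʳ V′ (subst (_∈ S) x≡πy x∈S))

      extend-double : ∀ {ρ} → Sat (⋀ d) ρ → Sat (⋀ (map (renBuiltIn π) d ++ d)) (extend ρ)
      extend-double {ρ} s =
        ⋀-++⁺ (map (renBuiltIn π) d)
          (proj₂ (⋀-ren π-injective d λ i → extend-copy ρ (∈-++⁺ʳ (fvAtoms K) i)) s)
          (⋀-cong d (λ i → extend-original ρ (∈-++⁺ʳ (fvAtoms K) i)) s)

    -- Here `δ` is `π` or `id`, according to the copy that holds the matched atom. For a solution
    -- `ρ` of `d`, the given guard is used at `extend ρ`; the values it provides for the head
    -- variables then also serve at `ρ`.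
    guard-single : ∀ {p} ts ts′ {C} δ →
      (∀ {x} → x ∈ fvTerms ts′ → x ∈ S) →
      (∀ {x} → x ∈ S → δ x ∈ varsConfig double) →
      (∀ M ρ {x} → x ∈ S → Extension.extend M ρ (δ x) ≡ ρ x) →
      Disjoint (fvAtoms [ p ⦅ ts ⦆ ] ++ varsBuiltIns C) (varsConfig double) →
      CT ⊨ ⋀ (map (renBuiltIn π) d ++ d) ⇒
        ex* (fvAtoms [ p ⦅ ts ⦆ ]) (⋀ ((Vec.toList (Vec.zipWith _≐_ ts (renTerms δ ts′)) ++ []) ++ C)) →
      CT ⊨ ⋀ d ⇒ ex* (fvAtoms [ p ⦅ ts ⦆ ]) (⋀ ((Vec.toList (Vec.zipWith _≐_ ts ts′) ++ []) ++ C))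
    guard-single {p} ts ts′ {C} δ ts′⊆S δS⊆double extend-δ disj grd M mod ρ s =
      subst (λ xs → Sat (ex* xs (⋀ ((Vec.toList (Vec.zipWith _≐_ ts ts′) ++ []) ++ C))) ρ)
        (map-id (fvAtoms [ p ⦅ ts ⦆ ]))
        (ex*-transport
          {⋀ ((Vec.toList (Vec.zipWith _≐_ ts (renTerms δ ts′)) ++ []) ++ C)}
          {⋀ ((Vec.toList (Vec.zipWith _≐_ ts ts′) ++ []) ++ C)}
          id Corr (fvAtoms [ p ⦅ ts ⦆ ]) update-corr transfer
          corr (grd M mod (extend ρ) (extend-double s)))
      where
      open Satisfaction M
      open Semantics M
      open Extension M

      -- The relation for `ex*-transport`: an update of a head variable acts alike on both
      -- assignments and, by freshness, changes no variable of the matched atom.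
      Corr : Assignment → Assignment → Set
      Corr ρ₁ ρ₂ = (∀ {x} → x ∈ fvAtoms [ p ⦅ ts ⦆ ] ++ varsBuiltIns C → ρ₂ x ≡ ρ₁ x) ×
                   (∀ {x} → x ∈ fvTerms ts′ → ρ₁ (δ x) ≡ ρ₂ x)

      corr : Corr (extend ρ) ρ
      -- Freshness puts the rule's variables outside the renamed copy, where `extend` changes
      -- nothing.
      corr = (λ i → sym (extend-other ρ λ j → let x , x∈S , eq = ∈-map⁻ π j in
               disj (i , subst (_∈ _) (sym eq) (πS⊆double x∈S)))) ,
             (λ i → extend-δ M ρ (ts′⊆S i))

      update-corr : ∀ {x ρ₁ ρ₂} a → x ∈ fvAtoms [ p ⦅ ts ⦆ ] → Corr ρ₁ ρ₂ →
                    Corr (ρ₁ [ x ↦ a ]) (ρ₂ [ x ↦ a ])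
      update-corr {x} {ρ₁} {ρ₂} a x∈H (on-rule , on-atom) =
        (λ i → update-agree {id} {ρ₁} {ρ₂} id x a on-rule i) ,
        (λ {y} i → trans (update-other ρ₁ a (x∉double (δS⊆double (ts′⊆S i))))
                  (trans (on-atom i) (sym (update-other ρ₂ a (x∉double (S⊆double (ts′⊆S i)))))))
        where
        x∉double : ∀ {y} → y ∈ varsConfig double → y ≢ x
        x∉double y∈ refl = disj (∈-++⁺ˡ x∈H , y∈)

      transfer : ∀ {ρ₁ ρ₂} → Corr ρ₁ ρ₂ →
        Sat (⋀ ((Vec.toList (Vec.zipWith _≐_ ts (renTerms δ ts′)) ++ []) ++ C)) ρ₁ →
        Sat (⋀ ((Vec.toList (Vec.zipWith _≐_ ts ts′) ++ []) ++ C)) ρ₂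
      transfer {ρ₁} {ρ₂} (on-rule , on-atom) t
        with tE , tC ← ⋀-++⁻ (Vec.toList (Vec.zipWith _≐_ ts (renTerms δ ts′)) ++ []) t
        with eqs , _ ← ≐⇒Pointwise ts (renTerms δ ts′) tE =
        ⋀-++⁺ (Vec.toList (Vec.zipWith _≐_ ts ts′) ++ [])
          (Pointwise⇒≐ ts ts′
            (subst₂ (Pointwise _≈_)
              (sym (evals-cong {ρ₁} {ρ₂} ts λ i → on-rule (∈-++⁺ˡ (∈-++⁺ˡ i))))
              (evals-ren {δ} {ρ₂} {ρ₁} ts′ on-atom) eqs) tt)
          (⋀-cong C (λ i → on-rule (∈-++⁺ʳ (fvAtoms [ p ⦅ ts ⦆ ]) i)) tC)

    -- This is where the bound on heads enters: a single atom is matched within one copy, whereas a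
    -- longer head could take atoms from both.
    fires-single : ∀ {H H′ K′ E C} B → length (List⁺.toList H) ≤ 1 →
      Disjoint (fvAtoms (List⁺.toList H) ++ varsBuiltIns C ++ vars B) (varsConfig double) →
      Config.store double ↭ H′ ++ K′ → List⁺.toList H ≗ H′ ↝ E →
      CT ⊨ ⋀ (Config.builtins double) ⇒ ex* (fvAtoms (List⁺.toList H)) (⋀ (E ++ C)) →
      ∃[ H″ ] ∃[ K″ ] ∃[ F ] (K ↭ H″ ++ K″ × (List⁺.toList H ≗ H″ ↝ F) ×
        (CT ⊨ ⋀ d ⇒ ex* (fvAtoms (List⁺.toList H)) (⋀ (F ++ C))))
    fires-single {(p ⦅ ts ⦆) ∷ []} {C = C} B _ disj q (ts′ ∷ []) grd = choose
      (∈-++⁻ (map (renAtom π) K) (∈-resp-↭ (↭-sym q) (here refl)))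
      where
      head-guard : Disjoint (fvAtoms [ p ⦅ ts ⦆ ] ++ varsBuiltIns C) (varsConfig double)
      head-guard {x} (i , j) = disj
        ( subst (x ∈_) (++-assoc (fvAtoms [ p ⦅ ts ⦆ ]) (varsBuiltIns C) (vars B)) (∈-++⁺ˡ i) , j)

      choose : p ⦅ ts′ ⦆ ∈ map (renAtom π) K ⊎ p ⦅ ts′ ⦆ ∈ K → _
      choose (inj₁ i) with h@(_ ⦅ us ⦆) , h∈K , refl ← ∈-map⁻ (renAtom π) i =
        [ h ] , proj₁ (∈⇒↭ h∈K) , _ , proj₂ (∈⇒↭ h∈K) , us ∷ [] ,
        guard-single {p} ts us {C} π
          (λ x∈us → ∈-++⁺ˡ (∈-concatMap⁺ fvAtom (lose h∈K x∈us)))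
          πS⊆double (λ M → Extension.extend-copy M) head-guard grd
      choose (inj₂ h∈K) =
        _ , proj₁ (∈⇒↭ h∈K) , _ , proj₂ (∈⇒↭ h∈K) , ts′ ∷ [] ,
        guard-single {p} ts ts′ {C} id
          (λ x∈ts′ → ∈-++⁺ˡ (∈-concatMap⁺ fvAtom (lose h∈K x∈ts′)))
          S⊆double (λ M → Extension.extend-original M) head-guard
          (subst (λ us → CT ⊨ ⋀ (Config.builtins double) ⇒
              ex* (fvAtoms [ p ⦅ ts ⦆ ]) (⋀ ((Vec.toList (Vec.zipWith _≐_ ts us) ++ []) ++ C)))
            (sym (renTerms-fix ts′ λ _ → refl)) grd)
    fires-single {_ ∷ _ ∷ _} _ (s≤s ())

    single-headed : ∀ {r} → FreshCopy Q V′ double r → length (head r) ≤ 1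
    single-headed (r₀ , σ , r₀∈Q , _ , refl , _) =
      subst (_≤ 1) (sym (renRule-head σ r₀)) (single r₀ r₀∈Q)

    fresh-disjoint : ∀ {r} → FreshCopy Q V′ double r → Disjoint (varsRule r) (varsConfig double)
    fresh-disjoint (_ , _ , _ , _ , _ , disj) (i , j) = disj (i , ∈-++⁺ʳ V′ j)

    double-final : Final Q V′ double
    double-final _ (solve q _) = ¬x∷xs↭[] (↭-sym q)
    double-final _ (introduce q) = ¬x∷xs↭[] (↭-sym q)
    double-final _ (simplify {H = H} {C} {B} fr q eqs grd)
      with _ , _ , _ , q′ , eqs′ , grd′ ←
             fires-single {H} {C = C} B (single-headed fr) (fresh-disjoint fr) q eqs grd =
      final _ (simplify (fresh-single fr) q′ eqs′ grd′)
    double-final _ (propagate {H = H} {C} {B} fr q eqs grd)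
      with _ , _ , _ , q′ , eqs′ , grd′ ←
             fires-single {H} {C = C} B (single-headed fr) (fresh-disjoint fr) q eqs grd =
      final _ (propagate (fresh-single fr) q′ eqs′ grd′)

  -- The first run keeps its variables, since those of `Ĝ` and of the waiting copy of `G` are
  -- variables of `G`, which the derivation already avoids. The second run is renamed apart from the
  -- outcome of the first; as `π` fixes the variables of `G`, it starts from the same goal.
  QA-doubled : ∀ {Q} → CHR[ 1 ] U Q → ∀ {G Ĝ} → Ĝ ↭ G ++ G → ∃ (QA Q G) → ∃ (QA Q Ĝ)
  QA-doubled {Q} single {G} {Ĝ} Ĝ↭ (_ , qualified {K} {d} derivation final) =
    run-twice (Once.steps-ren (Once.embeds goal-once refl refl) derivation)
    where
    ∈Ĝ⇒∈G : ∀ {x} → x ∈ vars Ĝ → x ∈ vars G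
    ∈Ĝ⇒∈G = concatMap-⊆ varsConstraint Ĝ G (λ i → [ id , id ]′ (∈-++⁻ G (∈-resp-↭ Ĝ↭ i)))

    ∈G⇒∈Ĝ : ∀ {x} → x ∈ vars G → x ∈ vars Ĝ
    ∈G⇒∈Ĝ = concatMap-⊆ varsConstraint G Ĝ (λ i → ∈-resp-↭ (↭-sym Ĝ↭) (∈-++⁺ˡ i))

    avoid-once : ∀ {x} → x ∉ vars G → x ∉ vars Ĝ ++ varsConfig ⟨ G , [] , [] ⟩
    avoid-once x∉G i with ∈-++⁻ (vars Ĝ) i
    ... | inj₁ j = x∉G (∈Ĝ⇒∈G j)
    ... | inj₂ j = x∉G (subst (_ ∈_) (++-identityʳ (vars G)) j)

    -- Identity renaming, with the second copy of `G` waiting as context.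
    module Once = Simulation Q (vars G) (vars Ĝ) id id G [] [] avoid-once

    goal-once : Ĝ ↭ map (renConstraint id) G ++ G
    goal-once = subst (λ G′ → Ĝ ↭ G′ ++ G)
      (sym (map-fix varsConstraint renConstraint renConstraint-fix {id} G λ _ → refl)) Ĝ↭

    separating : SeparatingRenaming (vars G) (vars Ĝ ++ varsConfig ⟨ [] , K , d ⟩)
    separating = separatingRenaming _ _
    open SeparatingRenaming separating

    -- The outcome `K`, `d` of the first run is now the context.
    module Twice = Simulation Q (vars G) (vars Ĝ) π π-injective [] K d avoids

    goal-twice : ∀ {G₁} → G₁ ↭ G → G₁ ↭ map (renConstraint π) G ++ []
    goal-twice p = ↭-trans p (↭-reflexive (sym (trans (++-identityʳ _)
      (map-fix varsConstraint renConstraint renConstraint-fix {π} G fixes))))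

    run-twice : ∃ (λ ĉ → Star (Step Q (vars Ĝ)) ⟨ Ĝ , [] , [] ⟩ ĉ × Once.Embeds ⟨ [] , K , d ⟩ ĉ) →
                ∃ (QA Q Ĝ)
    run-twice (⟨ G₁ , K₁ , d₁ ⟩ , first , Once.embeds p K₁≡ d₁≡)
      -- The identity renaming and the empty context leave exactly `K` and `d`.
      with refl ← trans K₁≡ (trans (++-identityʳ _)
                    (map-fix fvAtom renAtom renAtom-fix {id} K λ _ → refl))
         | refl ← trans d₁≡ (trans (++-identityʳ _)
                    (map-fix varsBuiltIn renBuiltIn renBuiltIn-fix {id} d λ _ → refl))
      with ⟨ G₂ , _ , _ ⟩ , second , Twice.embeds q refl refl ←
             Twice.steps-ren (Twice.embeds (goal-twice p) refl refl) derivation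
      -- With its goal empty, the configuration reached is `Doubling.double`.
      with refl ← ↭-empty-inv q =
      _ , qualified (first ◅◅ second)
            (Doubling.double-final Q single (vars G) (vars Ĝ) ∈G⇒∈Ĝ K d final separating)

  -- Data sufficient answers of programs without simplification rules.

  userPart-↭ : ∀ {G G′} → G ↭ G′ → userPart G ↭ userPart G′
  userPart-↭ ↭.refl = ↭.refl
  userPart-↭ (↭.prep (built c) p) = userPart-↭ p
  userPart-↭ (↭.prep (user h) p) = ↭.prep h (userPart-↭ p)
  userPart-↭ (↭.swap (built _) (built _) p) = userPart-↭ p
  userPart-↭ (↭.swap (built _) (user h) p) = ↭.prep h (userPart-↭ p)
  userPart-↭ (↭.swap (user h) (built _) p) = ↭.prep h (userPart-↭ p)
  userPart-↭ (↭.swap (user h) (user h′) p) = ↭.swap h h′ (userPart-↭ p)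
  userPart-↭ (↭.trans p q) = ↭.trans (userPart-↭ p) (userPart-↭ q)

  userPart-map-user : ∀ K → userPart (map user K) ≡ K
  userPart-map-user [] = refl
  userPart-map-user (h ∷ K) = cong (h ∷_) (userPart-map-user K)

  ⋀-builtPart-↭ : ∀ {M ρ G G′} → G ↭ G′ →
    Semantics.Sat M (⋀ (builtPart G)) ρ → Semantics.Sat M (⋀ (builtPart G′)) ρ
  ⋀-builtPart-↭ ↭.refl s = s
  ⋀-builtPart-↭ (↭.prep (built c) p) (s , ss) = s , ⋀-builtPart-↭ p ss
  ⋀-builtPart-↭ (↭.prep (user h) p) s = ⋀-builtPart-↭ p s
  ⋀-builtPart-↭ (↭.swap (built _) (built _) p) (s , s′ , ss) = s′ , s , ⋀-builtPart-↭ p ss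
  ⋀-builtPart-↭ (↭.swap (built _) (user _) p) (s , ss) = s , ⋀-builtPart-↭ p ss
  ⋀-builtPart-↭ (↭.swap (user _) (built _) p) (s , ss) = s , ⋀-builtPart-↭ p ss
  ⋀-builtPart-↭ (↭.swap (user _) (user _) p) s = ⋀-builtPart-↭ p s
  ⋀-builtPart-↭ {M} {ρ} (↭.trans p q) s = ⋀-builtPart-↭ {M} {ρ} q (⋀-builtPart-↭ {M} {ρ} p s)

  PropagationOnly : Program → Set
  PropagationOnly P = ∀ {H C B} → simplification H C B ∉ P

  no-simplification : ∀ {P} V c {H C B} → PropagationOnly P → ¬ FreshCopy P V c (simplification H C B)
  no-simplification _ _ only (simplification _ _ _ , _ , r∈P , _) = only r∈P
  no-simplification _ _ only (propagation _ _ _ , _ , _ , _ , () , _)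

  -- Nothing ever leaves the store, so if it ends empty, no atom was introduced and no rule fired,
  -- heads being nonempty. Only Solve steps remain, and their equivalences compose.
  emptied-store : ∀ {P V G K d d′} → PropagationOnly P →
    Star (Step P V) ⟨ G , K , d ⟩ ⟨ [] , [] , d′ ⟩ →
    K ≡ [] × userPart G ≡ [] × (CT ⊨ (⋀ (builtPart G) ∧ ⋀ d) ⇔ ⋀ d′)
  emptied-store only ε = refl , refl , λ M mod ρ → proj₂ , (tt ,_)
  emptied-store only (solve {G = G} {G′} {c = c} p eqv ◅ ss)
    with K≡[] , G′≡[] , eqv′ ← emptied-store only ss =
    K≡[] , ↭-empty-inv (subst (userPart G ↭_) G′≡[] (userPart-↭ p)) , λ M mod ρ →
      (λ (b , s) → let t , b′ = ⋀-builtPart-↭ {M} {ρ} p b in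
        proj₁ (eqv′ M mod ρ) (b′ , proj₁ (eqv M mod ρ) (t , s))) ,
      (λ s → let b′ , s′ = proj₂ (eqv′ M mod ρ) s
                 t , s″ = proj₂ (eqv M mod ρ) s′ in
        ⋀-builtPart-↭ {M} {ρ} (↭-sym p) (t , b′) , s″)
  emptied-store only (introduce p ◅ ss) with () , _ ← emptied-store only ss
  emptied-store {V = V} only (_◅_ {i = c} (simplify fr _ _ _) ss) =
    contradiction fr (no-simplification V c only)
  emptied-store only (propagate fr p (ts′ ∷ eqs) _ ◅ ss) with () , _ ← emptied-store only ss

  propagationOnly⇒onlyTrivialSA : ∀ {P} → PropagationOnly P → OnlyTrivialSA U P
  propagationOnly⇒onlyTrivialSA only G _ (sufficient steps _)
    with _ , G≡[] , eqv ← emptied-store only steps rewrite G≡[] =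
    -- Both answers leave `Fv G` free, so the assignment `ρ₁` is its own witness in each direction.
    (λ M mod ρ ρ₁ agr s k → k (ρ₁ , agr , proj₁ (proj₂ (eqv M mod ρ₁) s) , Homogeneous.refl [])) ,
    (λ M mod ρ ρ₁ agr s k → k (ρ₁ , agr , proj₁ (eqv M mod ρ₁) (s , tt) , Homogeneous.refl []))

  -- The program that propagates on two copies of a ground atom.

  module Pairing (h : Atom) (ground : fvAtom h ≡ []) where

    pair : List Atom
    pair = h ∷ h ∷ []

    rule : Rule
    rule = propagation (h ∷ [ h ]) [] []

    P : Program
    P = [ rule ]

    P-trivial : OnlyTrivialSA U P
    P-trivial = propagationOnly⇒onlyTrivialSA λ where
      (here ())
      (there ())

    -- Groundness leaves no variable to rename, so every fresh copy of a rule of `P` is `rule`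
    -- itself.
    rule-ren : ∀ π → renRule π rule ≡ rule
    rule-ren π rewrite renAtom-fix {π} h (λ i → contradiction (subst (_ ∈_) ground i) λ ()) = refl

    rule-closed : varsRule rule ≡ []
    rule-closed rewrite ground = refl

    fresh⇒rule : ∀ V c {r} → FreshCopy P V c r → r ≡ rule
    fresh⇒rule _ _ (_ , π , here refl , _ , eq , _) = trans eq (rule-ren π)

    rule-fresh : ∀ V c → FreshCopy P V c rule
    rule-fresh _ _ = rule , id , here refl , id , sym (rule-ren id) ,
      λ (i , _) → contradiction (subst (_ ∈_) rule-closed i) λ ()

    h≗h : List BuiltIn
    h≗h = Vec.toList (Vec.zipWith _≐_ (Atom.args h) (Atom.args h))

    -- By groundness the quantifier prefix is empty, and only reflexive equations are left.
    guard-holds : ∀ {d} → CT ⊨ ⋀ d ⇒ ex* (fvAtoms pair) (⋀ ((h≗h ++ h≗h ++ []) ++ []))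
    guard-holds M mod ρ _ rewrite ground =
      ⋀-++⁺ (h≗h ++ h≗h ++ [])
        (Pointwise⇒≐ (Atom.args h) (Atom.args h) args≈args
          (Pointwise⇒≐ (Atom.args h) (Atom.args h) args≈args tt)) tt
      where
      open Satisfaction M
      open Semantics M
      args≈args = Vecᴾ.refl (IsEquivalence.refl isEquivalence) {x = evals ρ (Atom.args h)}

    pair-not-final : ∀ {V K d} → K ↭ pair → ¬ Final P V ⟨ [] , K , d ⟩
    pair-not-final {V} {K} {d} K↭pair final =
      final _ (propagate {H′ = pair} {[]} (rule-fresh V ⟨ [] , K , d ⟩) K↭pair (_ ∷ _ ∷ []) (guard-holds {d}))

    no-match-single : ∀ {H C B H′ K′ E} → propagation H C B ≡ rule →
                      [ h ] ↭ H′ ++ K′ → ¬ (List⁺.toList H ≗ H′ ↝ E)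
    no-match-single refl p (_ ∷ _ ∷ []) with () ← ↭-length p

    single-final : ∀ {V d} → Final P V ⟨ [] , [ h ] , d ⟩
    single-final _ (solve p _) = ¬x∷xs↭[] (↭-sym p)
    single-final _ (introduce p) = ¬x∷xs↭[] (↭-sym p)
    single-final {V} {d} _ (simplify fr _ _ _) = contradiction (fresh⇒rule V ⟨ [] , [ h ] , d ⟩ fr) λ ()
    single-final {V} {d} _ (propagate fr p eqs _) =
      no-match-single (fresh⇒rule V ⟨ [] , [ h ] , d ⟩ fr) p eqs

    QA-single : QA P [ user h ] (ans (Fv [ user h ]) [ h ] [])
    QA-single = qualified (introduce ↭-refl ◅ ε) single-final

    contents : Config → Goal
    contents ⟨ G , K , _ ⟩ = map user K ++ G

    -- Introduce moves an atom from the goal to the store, firing `rule` keeps the head and adds an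
    -- empty body, and Solve finds no built-in to act on.
    step-contents : ∀ {V c c′} → Step P V c c′ → contents c ↭ map user pair → contents c′ ↭ map user pair
    step-contents (solve {K = K} p _) inv
      with ∈-map⁻ user (∈-resp-↭ inv (∈-++⁺ʳ (map user K) (∈-resp-↭ (↭-sym p) (here refl))))
    ... | _ , _ , ()
    step-contents (introduce {G′ = G′} {K} p) inv =
      ↭-trans (↭-sym (Perm.shift _ (map user K) G′))
        (↭-trans (Perm.++⁺ˡ (map user K) (↭-sym p)) inv)
    step-contents {V} {c} (simplify fr _ _ _) inv = contradiction (fresh⇒rule V c fr) λ ()
    step-contents {V} {c} (propagate {G = G} fr p _ _) inv with refl ← fresh⇒rule V c fr =
      ↭-trans (Perm.++⁺ʳ G (Perm.map⁺ user (↭-sym p))) inv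

    steps-contents : ∀ {V c c′} → Star (Step P V) c c′ → contents c ↭ map user pair →
                     contents c′ ↭ map user pair
    steps-contents ε inv = inv
    steps-contents (s ◅ ss) inv = steps-contents ss (step-contents s inv)

    -- Once the goal is empty, the preserved contents are all in the store, so both copies of `h`
    -- are there and `rule` can fire again.
    no-QA-pair : ∀ {A} → ¬ QA P (map user pair) A
    no-QA-pair (qualified {K} steps final) = pair-not-final K↭pair final
      where
      K↭pair : K ↭ pair
      K↭pair = subst₂ _↭_
        (trans (cong userPart (++-identityʳ (map user K))) (userPart-map-user K)) refl
        (userPart-↭ (steps-contents steps ↭-refl))

-- Refuting an encoding on the goals h and h, h.

theorem4p6 : (Sg : Signature) (CT : Logic.Theory Sg) →
    (∃[ a ] Signature.funArity Sg a ≡ 0) →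
    (∃[ f ] 0 < Signature.funArity Sg f) →
    (U W : Vocabulary Sg) → Vocabulary.Sym U →
    (n : ℕ) → 2 ≤ n →
    {ℓ : Level} (𝒢 : Pred (CHR.Language.Goal Sg CT U) ℓ) →
    CHR.ContainsSubheads Sg CT U (CHR.CHR[_,t] Sg CT n U) 𝒢 →
    ¬ CHR.AcceptableEncodingQA Sg CT U W (CHR.CHR[_,t] Sg CT n U) (CHR.CHR[_] Sg CT 1 W) 𝒢
theorem4p6 Sg CT (a , a-constant) _ U W p n 2≤n 𝒢 subheads enc =
  -- The second half of `preserves` takes an answer of the encoded pair back to an answer of the
  -- pair in `P`.
  no-QA-pair (proj₁ (proj₂ (proj₂ (preserves P-in-CHR[n,t] (map user pair) pair∈𝒢) _ (proj₂ QA-encoded-pair))))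
  where
  open CHR Sg CT
  open Language U using (user; _⦅_⦆)
  open AcceptableEncodingQA enc

  closed-args : ∀ {m} (e : m ≡ 0) → fvTerms (subst (Vec Term) (sym e) []) ≡ []
  closed-args refl = refl

  -- Filling every argument place with a constant makes an atom ground, whatever the arity of its
  -- predicate.
  constant : Term
  constant = fun a (subst (Vec Term) (sym a-constant) [])

  closed-replicate : ∀ k → fvTerms (Vec.replicate k constant) ≡ []
  closed-replicate zero = refl
  closed-replicate (suc k) rewrite closed-args a-constant = closed-replicate k

  open Operational.Pairing Sg CT U (p ⦅ Vec.replicate _ constant ⦆) (closed-replicate (uArity (Vocabulary.name U p)))

  P-in-CHR[n,t] : ∃ (CHR[ n ,t] U)
  P-in-CHR[n,t] = P , (λ { _ (here refl) → 2≤n }) , P-trivial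

  -- One atom is a proper part of the head of `rule` and the pair is all of it, so closure of `𝒢`
  -- under subheads yields both goals.
  single∈𝒢 : 𝒢 (map user [ _ ])
  single∈𝒢 = subheads P (proj₂ P-in-CHR[n,t]) rule (here refl) [ _ ] [ _ ] ↭-refl

  pair∈𝒢 : 𝒢 (map user pair)
  pair∈𝒢 = subheads P (proj₂ P-in-CHR[n,t]) rule (here refl) pair [] ↭-refl

  QA-encoded-single : ∃ (Language.QA W (proj₁ (encP P-in-CHR[n,t])) (encG (map user [ _ ])))
  QA-encoded-single with B , B∈QA , _ ← proj₁ (preserves P-in-CHR[n,t] _ single∈𝒢) _ QA-single = B , B∈QA

  QA-encoded-pair : ∃ (Language.QA W (proj₁ (encP P-in-CHR[n,t])) (encG (map user pair)))
  QA-encoded-pair = Operational.QA-doubled Sg CT W (proj₂ (encP P-in-CHR[n,t]))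
    -- Compositionality makes the encoded pair, up to permutation, two copies of one goal.
    (encG-++ (map user [ _ ]) (map user [ _ ])) QA-encoded-single
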